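{- The book Ramsey number $R(B_8,B_{10})$ is equal to $37$.
   Context: All graphs are finite and simple. For graphs $G$ and $H$, the Ramsey number $R(G,H)$ is the smallest integer $n$ such that every graph on $n$ vertices contains $G$ as a subgraph (not necessarily induced) or its complement contains $H$ as a subgraph (not necessarily induced). For $t\ge 1$, the book graph $B_t$ is the graph consisting of $t$ triangles sharing a common edge; equivalently, $B_t$ is the graph on $t+2$ vertices obtained from an edge $uv$ by adding $t$ further vertices, each adjacent to both $u$ and $v$ (and with no other edges). -}

module Defs where

open import Data.Fin.Base using (Fin; zero; suc)
open import Data.Fin.Properties using (_≟_)
open import Data.Nat.Base using (ℕ; _+_; _≤_)
open import Data.Product.Base using (_×_; _,_; Σ-syntax)
open import Data.Sum.Base using (_⊎_; inj₁; inj₂)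
open import Function.Definitions using (Injective)
open import Level using (0ℓ)
open import Relation.Binary.Construct.Closure.Symmetric using (SymClosure; fwd; bwd; symmetric)
open import Relation.Binary.Core using (Rel)
open import Relation.Binary.Definitions using (Decidable; Irreflexive; Symmetric)
open import Relation.Binary.PropositionalEquality using (_≡_; _≢_; refl; ≢-sym)
open import Relation.Nullary.Decidable using (yes; no; map′; _×-dec_; _⊎-dec_; ¬?)
open import Relation.Nullary.Negation using (¬_)

-- Adjacency is required to be decidable, as it is classically for every
-- finite graph; otherwise a constructive "every graph" would also range over
-- relations that cannot be split into edges and non-edges.
record Graph (n : ℕ) : Set₁ where
  field
    Adj    : Rel (Fin n) 0ℓ
    sym    : Symmetric Adj
    irrefl : Irreflexive _≡_ Adj
    adj?   : Decidable Adj

open Graph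

complement : ∀ {n} → Graph n → Graph n
complement G .Adj i j = i ≢ j × ¬ Adj G i j
complement G .sym (i≢j , ¬ij) = ≢-sym i≢j , λ ji → ¬ij (sym G ji)
complement G .irrefl i≡j (i≢j , _) = i≢j i≡j
complement G .adj? i j = ¬? (i ≟ j) ×-dec ¬? (adj? G i j)

-- H has a (not necessarily induced) subgraph isomorphic to G.
_⊑_ : ∀ {m n} → Graph m → Graph n → Set
_⊑_ {m} {n} G H =
  Σ[ f ∈ (Fin m → Fin n) ]
    Injective _≡_ _≡_ f × (∀ {i j} → Adj G i j → Adj H (f i) (f j))

-- The common edge uv joins u = 0 and v = 1; the t further vertices are the
-- suc (suc k).
data BookEdge {t : ℕ} : Rel (Fin (2 + t)) 0ℓ where
  uv : BookEdge zero (suc zero)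
  uw : ∀ k → BookEdge zero (suc (suc k))
  vw : ∀ k → BookEdge (suc zero) (suc (suc k))

bookEdge? : ∀ {t} → Decidable (BookEdge {t})
bookEdge? zero          zero          = no λ ()
bookEdge? zero          (suc zero)    = yes uv
bookEdge? zero          (suc (suc k)) = yes (uw k)
bookEdge? (suc zero)    zero          = no λ ()
bookEdge? (suc zero)    (suc zero)    = no λ ()
bookEdge? (suc zero)    (suc (suc k)) = yes (vw k)
bookEdge? (suc (suc _)) _             = no λ ()

book : ∀ t → Graph (2 + t)
book t .Adj = SymClosure BookEdge
book t .sym = symmetric BookEdge
book t .irrefl refl (fwd ())
book t .irrefl refl (bwd ())
book t .adj? i j = map′ to from (bookEdge? i j ⊎-dec bookEdge? j i)
  where
  to : BookEdge i j ⊎ BookEdge j i → SymClosure BookEdge i j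
  to (inj₁ e) = fwd e
  to (inj₂ e) = bwd e
  from : SymClosure BookEdge i j → BookEdge i j ⊎ BookEdge j i
  from (fwd e) = inj₁ e
  from (bwd e) = inj₂ e

RamseyProperty : ∀ {a b} → Graph a → Graph b → ℕ → Set₁
RamseyProperty G H n = (F : Graph n) → G ⊑ F ⊎ H ⊑ complement F

-- R(G,H) = n, stated as a relation so that the existence of Ramsey numbers
-- is not presupposed.
IsRamseyNumber : ∀ {a b} → Graph a → Graph b → ℕ → Set₁
IsRamseyNumber G H n =
  RamseyProperty G H n × (∀ m → RamseyProperty G H m → n ≤ m)

{-# OPTIONS --safe #-}
module Submission where

-- Call the edges of a graph red and the edges of its complement blue. A graph
-- contains the book with t pages exactly when some edge has at least t common
-- neighbours (book-from-edge, edge-from-book), so the claim is about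
-- codegrees: the number of common red neighbours of a red pair and the number
-- of common blue neighbours of a blue pair.
--
-- Lower bound. F₃₆ is a graph on two copies of the integers mod 18, invariant
-- under the simultaneous translation of both copies. Evaluation shows that red
-- pairs have at most 7 common red neighbours and blue pairs at most 9 common
-- blue neighbours, so F₃₆ avoids both books; induced subgraphs of F₃₆ do so on
-- fewer vertices.
--
-- Upper bound. Suppose that a graph on 37 vertices has red codegrees at most 7
-- and blue codegrees at most 9. Count monochromatic triangles as Goodman does:
-- adding up the differences between these bounds and the actual codegrees
-- over all ordered pairs gives minus the sum over all vertices x of
-- (3 d(x) - 52)(d(x) - 18), where d(x) is the red degree (Extremal.total).
-- For integers this product is nonnegative and vanishes only at d(x) = 18.
-- Hence everything is tight: the graph is strongly regular with parameters
-- (37, 18, 7, 10), that is, its adjacency matrix A has row sums 18 and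
-- satisfies A² = 8 I - 3 A + 10 J, where J is the all-ones matrix.
--
-- No such graph exists. The nontrivial eigenvalues are the irrational conjugates
-- (-3 ± √41) / 2, so they would have equal multiplicity 18, which makes the
-- trace of A equal to 18 - 54 instead of 0. The argument below replaces the
-- eigenvalues by counting modulo 7 (modulo which 41 is not a square). The
-- matrix identity determines the number of closed walks of length 7, that is,
-- the trace of A⁷: it is 37 times 16529526, which is not divisible by 7
-- (StronglyRegular.closed7Walks). On the other hand, cyclic rotation acts
-- freely on closed walks of prime length p in a loopless graph, because a word
-- of length p fixed by a nontrivial rotation is constant; so their number is
-- divisible by p (prime∣closedWalks).

open import Defs

open import Data.Bool.Base using (if_then_else_; true; false)
open import Data.Fin.Base using (Fin; zero; suc; toℕ; fromℕ<; inject≤; remQuot)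
import Data.Fin.Properties as Fin
open import Data.Integer.Base as ℤ using (ℤ; +_; -[1+_]; 0ℤ; 1ℤ; _+_; _-_; _*_; -_; _≤_)
import Data.Integer.Properties as ℤ
open import Data.Integer.Tactic.RingSolver using (solve-∀)
open import Data.List.Base using (List; []; _∷_; _++_; [_]; length; filter; allFin; tabulate; lookup)
import Data.List.Extrema as Extrema
open import Data.List.Membership.Propositional using (_∈_)
open import Data.List.Membership.Propositional.Properties using (∈-filter⁺; ∈-filter⁻; ∈-allFin; ∈-lookup)
import Data.List.Properties as List
import Data.List.Relation.Binary.Lex.NonStrict as Lex
open import Data.List.Relation.Binary.Pointwise using (Pointwise-≡⇒≡)
import Data.List.Relation.Unary.All as All
open import Data.List.Relation.Unary.AllPairs using (_∷_)
open import Data.List.Relation.Unary.Any using (index)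
open import Data.List.Relation.Unary.Any.Properties using (lookup-index)
open import Data.List.Relation.Unary.Unique.Propositional using (Unique)
import Data.List.Relation.Unary.Unique.Propositional.Properties as Unique
open import Data.Nat.Base as ℕ using (ℕ; zero; suc; NonZero)
open import Data.Nat.Coprimality using (prime⇒coprime; coprime-Bézout)
open import Data.Nat.Divisibility using (_∣_; _∣?_; m∣m*n)
open import Data.Nat.DivMod using (_%_; _/_; m≡m%n+[m/n]*n; m%n<n)
open import Data.Nat.GCD using (module Bézout)
open import Data.Nat.GeneralisedArithmetic using (fold; fold-+)
open import Data.Nat.Primality using (Prime; prime?; prime⇒nonZero)
import Data.Nat.Properties as ℕ
open import Data.List.Membership.DecPropositional ℕ._≟_ using () renaming (_∈?_ to _∈ℕ?_)
open import Data.Product.Base using (Σ-syntax; ∃-syntax; _×_; _,_; proj₁; proj₂)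
open import Data.Sum.Base using (_⊎_; inj₁; inj₂)
open import Function.Base using (_∘_; id; case_of_)
open import Function.Definitions using (Injective)
open import Relation.Binary.Bundles using (DecTotalOrder)
open import Relation.Binary.Construct.Closure.Symmetric using (fwd; bwd)
open import Relation.Binary.Definitions using (Decidable; tri<; tri≈; tri>)
open import Relation.Binary.PropositionalEquality
  using (_≡_; _≢_; refl; sym; trans; cong; cong₂; subst; module ≡-Reasoning)
open import Relation.Nullary.Decidable
  using (Dec; does; yes; no; toWitness; from-yes; from-no; dec-true; dec-false; _×-dec_; _→-dec_; ¬?)
open import Relation.Nullary.Negation using (¬_; contradiction)

open import Algebra.Properties.Semiring.Sum ℤ.+-*-semiring
  using (sum; sum-syntax; sum-cong-≗; ∑-distrib-+; ∑-comm; *-distribˡ-sum; *-distribʳ-sum; sum-replicate-zero)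

open Graph renaming (sym to adj-sym)

private
  variable
    n t : ℕ

-- Books and common neighbours

lookup-injective : ∀ {A : Set} {xs : List A} → Unique xs → Injective _≡_ _≡_ (lookup xs)
lookup-injective (_  ∷ _)   {zero}  {zero}  _  = refl
lookup-injective (x∉ ∷ _)   {zero}  {suc j} eq = contradiction eq (All.lookup x∉ (∈-lookup j))
lookup-injective (x∉ ∷ _)   {suc i} {zero}  eq = contradiction (sym eq) (All.lookup x∉ (∈-lookup i))
lookup-injective (_  ∷ xs!) {suc i} {suc j} eq = cong suc (lookup-injective xs! eq)

-- The common neighbours of x and y, listed without repetition, so that their
-- number is the length of the list.
commonNeighbours : Graph n → Fin n → Fin n → List (Fin n)
commonNeighbours G x y = filter (λ z → adj? G x z ×-dec adj? G y z) (allFin _)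

module _ (G : Graph n) (x y : Fin n) where

  ∈-common⁻ : ∀ {z} → z ∈ commonNeighbours G x y → Adj G x z × Adj G y z
  ∈-common⁻ z∈ = proj₂ (∈-filter⁻ (λ z → adj? G x z ×-dec adj? G y z) {xs = allFin _} z∈)

  ∈-common⁺ : ∀ {z} → Adj G x z → Adj G y z → z ∈ commonNeighbours G x y
  ∈-common⁺ {z} xz yz = ∈-filter⁺ _ (∈-allFin z) (xz , yz)

  common-unique : Unique (commonNeighbours G x y)
  common-unique = Unique.filter⁺ _ (Unique.allFin⁺ _)

-- The pages of the book are the first t common neighbours.
book-from-edge : (G : Graph n) {x y : Fin n} → Adj G x y →
                 t ℕ.≤ length (commonNeighbours G x y) → book t ⊑ G
book-from-edge {t = t} G {x} {y} xy t≤ = f , f-injective , f-edge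
  where
  page : Fin t → Fin _
  page k = lookup (commonNeighbours G x y) (inject≤ k t≤)

  page-adj : ∀ k → Adj G x (page k) × Adj G y (page k)
  page-adj k = ∈-common⁻ G x y (∈-lookup (inject≤ k t≤))

  page-injective : Injective _≡_ _≡_ page
  page-injective eq = Fin.inject≤-injective t≤ t≤ _ _
    (lookup-injective (common-unique G x y) eq)

  f : Fin (2 ℕ.+ t) → Fin _
  f zero          = x
  f (suc zero)    = y
  f (suc (suc k)) = page k

  adj⇒≢ : ∀ {v w} → Adj G v w → v ≢ w
  adj⇒≢ vv refl = irrefl G refl vv

  f-injective : Injective _≡_ _≡_ f
  f-injective {zero}        {zero}        _  = refl
  f-injective {zero}        {suc zero}    eq = contradiction eq (adj⇒≢ xy)
  f-injective {zero}        {suc (suc k)} eq = contradiction eq (adj⇒≢ (proj₁ (page-adj k)))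
  f-injective {suc zero}    {zero}        eq = contradiction (sym eq) (adj⇒≢ xy)
  f-injective {suc zero}    {suc zero}    _  = refl
  f-injective {suc zero}    {suc (suc k)} eq = contradiction eq (adj⇒≢ (proj₂ (page-adj k)))
  f-injective {suc (suc k)} {zero}        eq = contradiction (sym eq) (adj⇒≢ (proj₁ (page-adj k)))
  f-injective {suc (suc k)} {suc zero}    eq = contradiction (sym eq) (adj⇒≢ (proj₂ (page-adj k)))
  f-injective {suc (suc k)} {suc (suc l)} eq = cong (λ i → suc (suc i)) (page-injective eq)

  f-bookEdge : ∀ {i j} → BookEdge i j → Adj G (f i) (f j)
  f-bookEdge uv     = xy
  f-bookEdge (uw k) = proj₁ (page-adj k)
  f-bookEdge (vw k) = proj₂ (page-adj k)

  f-edge : ∀ {i j} → Adj (book t) i j → Adj G (f i) (f j)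
  f-edge (fwd e) = f-bookEdge e
  f-edge (bwd e) = adj-sym G (f-bookEdge e)

-- The images of the pages are distinct common neighbours of the images of the
-- spine, so the pigeonhole principle bounds their number from below.
edge-from-book : (G : Graph n) → book t ⊑ G →
                 ∃[ x ] ∃[ y ] Adj G x y × t ℕ.≤ length (commonNeighbours G x y)
edge-from-book {t = t} G (f , f-inj , f-edge) = x , y , f-edge (fwd uv) , ℕ.≮⇒≥ tooFew
  where
  x = f zero
  y = f (suc zero)

  page∈ : ∀ k → f (suc (suc k)) ∈ commonNeighbours G x y
  page∈ k = ∈-common⁺ G x y (f-edge (fwd (uw k))) (f-edge (fwd (vw k)))

  tooFew : ¬ length (commonNeighbours G x y) ℕ.< t
  tooFew lt with Fin.pigeonhole lt (index ∘ page∈)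
  ... | k , l , k<l , eq = Fin.<⇒≢ k<l (Fin.suc-injective (Fin.suc-injective (f-inj (begin
    f (suc (suc k))                                    ≡⟨ lookup-index (page∈ k) ⟩
    lookup (commonNeighbours G x y) (index (page∈ k))  ≡⟨ cong (lookup (commonNeighbours G x y)) eq ⟩
    lookup (commonNeighbours G x y) (index (page∈ l))  ≡⟨ lookup-index (page∈ l) ⟨
    f (suc (suc l))                                    ∎))))
    where open ≡-Reasoning

-- The lower bound

-- The pullback of a graph along a map of vertices; for an injective map it is
-- an induced subgraph.
induced : ∀ {m n} → Graph n → (Fin m → Fin n) → Graph m
induced G f .Adj i j    = Adj G (f i) (f j)
induced G f .adj-sym    = adj-sym G
induced G f .irrefl i≡j = irrefl G (cong f i≡j)
induced G f .adj? i j   = adj? G (f i) (f j)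

⊑-trans-induced : ∀ {k m n} {H : Graph k} (G : Graph n) {f : Fin m → Fin n} →
                  Injective _≡_ _≡_ f → H ⊑ induced G f → H ⊑ G
⊑-trans-induced G {f} f-inj (g , g-inj , g-edge) = f ∘ g , g-inj ∘ f-inj , g-edge

-- A graph on n vertices inherits its books from its restriction to the first m
-- vertices, and restriction commutes with complementation.
RamseyProperty-mono : ∀ {a b m n} {G : Graph a} {H : Graph b} → m ℕ.≤ n →
                      RamseyProperty G H m → RamseyProperty G H n
RamseyProperty-mono {G = G} m≤n R F with R (induced F (λ i → inject≤ i m≤n))
... | inj₁ G⊑ = inj₁ (⊑-trans-induced {H = G} F (Fin.inject≤-injective m≤n m≤n _ _) G⊑)
... | inj₂ (g , g-inj , g-edge) = inj₂
  ( (λ i → inject≤ (g i) m≤n)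
  , g-inj ∘ Fin.inject≤-injective m≤n m≤n _ _
  , (λ e → let (i≢j , ¬ij) = g-edge e in i≢j ∘ Fin.inject≤-injective m≤n m≤n _ _ , ¬ij))

-- The connection sets of F₃₆: D₀ and D₁ within the two copies of the integers
-- mod 18, and E from copy 0 to copy 1. The sets come from a computer search.
D₀ D₁ E : List ℕ
D₀ = 2 ∷ 3 ∷ 4 ∷ 5 ∷ 9 ∷ 13 ∷ 14 ∷ 15 ∷ 16 ∷ []
D₁ = 1 ∷ 6 ∷ 7 ∷ 8 ∷ 10 ∷ 11 ∷ 12 ∷ 17 ∷ []
E  = 2 ∷ 5 ∷ 6 ∷ 8 ∷ 10 ∷ 13 ∷ 14 ∷ 16 ∷ []

-- The residue of j - i mod 18; adding 18 first keeps the subtraction exact.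
difference : Fin 18 → Fin 18 → ℕ
difference i j = (18 ℕ.+ toℕ j ℕ.∸ toℕ i) % 18

-- Adjacency of the vertices (copy , residue). An edge between the copies is
-- determined by the residue in copy 1 minus the residue in copy 0.
_~_ : Fin 2 × Fin 18 → Fin 2 × Fin 18 → Set
(zero     , i) ~ (zero     , j) = difference i j ∈ D₀
(zero     , i) ~ (suc zero , j) = difference i j ∈ E
(suc zero , i) ~ (zero     , j) = difference j i ∈ E
(suc zero , i) ~ (suc zero , j) = difference i j ∈ D₁

_~?_ : Decidable _~_
(zero     , i) ~? (zero     , j) = difference i j ∈ℕ? D₀
(zero     , i) ~? (suc zero , j) = difference i j ∈ℕ? E
(suc zero , i) ~? (zero     , j) = difference j i ∈ℕ? E
(suc zero , i) ~? (suc zero , j) = difference i j ∈ℕ? D₁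

vertex : Fin 36 → Fin 2 × Fin 18
vertex = remQuot 18

-- The vertices of the 36-vertex graph are numbered by 18 * copy + residue. Its
-- symmetry and irreflexivity hold because D₀ and D₁ are closed under negation
-- and avoid 0; here they are evaluated.
F₃₆ : Graph 36
F₃₆ .Adj x y = vertex x ~ vertex y
F₃₆ .adj-sym {x} {y} = toWitness
  {a? = Fin.all? λ x → Fin.all? λ y → (vertex x ~? vertex y) →-dec (vertex y ~? vertex x)} _ x y
F₃₆ .irrefl {x} refl = toWitness {a? = Fin.all? λ x → ¬? (vertex x ~? vertex x)} _ x
F₃₆ .adj? x y = vertex x ~? vertex y

-- Every edge lies in at most t triangles.
BoundedCommon : Graph n → ℕ → Set
BoundedCommon {n} G t = ∀ (x y : Fin n) → Adj G x y → length (commonNeighbours G x y) ℕ.≤ t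

boundedCommon? : (G : Graph n) (t : ℕ) → Dec (BoundedCommon G t)
boundedCommon? G t = Fin.all? λ x → Fin.all? λ y →
  adj? G x y →-dec (length (commonNeighbours G x y) ℕ.≤? t)

bounded⇒no-book : (G : Graph n) → BoundedCommon G t → ¬ book (suc t) ⊑ G
bounded⇒no-book G bounded B with edge-from-book G B
... | x , y , xy , t< = ℕ.<⇒≱ t< (bounded x y xy)

F₃₆-bounded : BoundedCommon F₃₆ 7
F₃₆-bounded = toWitness {a? = boundedCommon? F₃₆ 7} _

F₃₆-co-bounded : BoundedCommon (complement F₃₆) 9
F₃₆-co-bounded = toWitness {a? = boundedCommon? (complement F₃₆) 9} _

¬Ramsey36 : ¬ RamseyProperty (book 8) (book 10) 36
¬Ramsey36 R with R F₃₆
... | inj₁ B = bounded⇒no-book F₃₆ F₃₆-bounded B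
... | inj₂ B = bounded⇒no-book (complement F₃₆) F₃₆-co-bounded B

ramsey-lower : ∀ m → RamseyProperty (book 8) (book 10) m → 37 ℕ.≤ m
ramsey-lower m R = ℕ.≮⇒≥ λ m<37 →
  ¬Ramsey36 (RamseyProperty-mono {G = book 8} {H = book 10} (ℕ.s≤s⁻¹ m<37) R)

-- Finite sums and indicators

-- The indicator of a decidable proposition.
𝟙 : ∀ {P : Set} → Dec P → ℤ
𝟙 P? = if does P? then 1ℤ else 0ℤ

𝟙-yes : ∀ {P : Set} (P? : Dec P) → P → 𝟙 P? ≡ 1ℤ
𝟙-yes P? p = cong (if_then 1ℤ else 0ℤ) (dec-true P? p)

𝟙-no : ∀ {P : Set} (P? : Dec P) → ¬ P → 𝟙 P? ≡ 0ℤ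
𝟙-no P? ¬p = cong (if_then 1ℤ else 0ℤ) (dec-false P? ¬p)

-- The Kronecker delta, that is, the entries of the identity matrix.
δ : Fin n → Fin n → ℤ
δ x y = 𝟙 (x Fin.≟ y)

sum-zero : (f : Fin n → ℤ) → (∀ x → f x ≡ 0ℤ) → sum f ≡ 0ℤ
sum-zero {n} f f≡0 = trans (sum-cong-≗ f≡0) (sum-replicate-zero n)

sum-const : ∀ n c → ∑[ x < n ] c ≡ + n * c
sum-const zero    c = refl
sum-const (suc n) c = trans (cong (_+_ c) (sum-const n c)) (sym (ℤ.suc-* (+ n) c))

sum-δ : (x : Fin n) (f : Fin n → ℤ) → ∑[ z < n ] (δ x z * f z) ≡ f x
sum-δ {suc n} zero f = begin
  1ℤ * f zero + ∑[ z < n ] (δ zero (suc z) * f (suc z))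
    ≡⟨ cong₂ _+_ (ℤ.*-identityˡ (f zero)) (sum-zero {n} _ λ z → ℤ.*-zeroˡ (f (suc z))) ⟩
  f zero + 0ℤ ≡⟨ ℤ.+-identityʳ _ ⟩
  f zero ∎
  where open ≡-Reasoning
sum-δ {suc n} (suc x) f = begin
  0ℤ * f zero + ∑[ z < n ] (δ x z * f (suc z)) ≡⟨ cong₂ _+_ (ℤ.*-zeroˡ (f zero)) (sum-δ x (f ∘ suc)) ⟩
  0ℤ + f (suc x) ≡⟨ ℤ.+-identityˡ _ ⟩
  f (suc x) ∎
  where open ≡-Reasoning

𝟙-× : ∀ {P Q : Set} (P? : Dec P) (Q? : Dec Q) → 𝟙 (P? ×-dec Q?) ≡ 𝟙 P? * 𝟙 Q?
𝟙-× (yes _) (yes _) = refl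
𝟙-× (yes _) (no  _) = refl
𝟙-× (no  _) (yes _) = refl
𝟙-× (no  _) (no  _) = refl

𝟙-idem : ∀ {P : Set} (P? : Dec P) → 𝟙 P? * 𝟙 P? ≡ 𝟙 P?
𝟙-idem (yes _) = refl
𝟙-idem (no  _) = refl

length-filter-tabulate : {A : Set} {P : A → Set} (P? : ∀ x → Dec (P x)) (f : Fin n → A) →
                         + length (filter P? (tabulate f)) ≡ ∑[ i < n ] 𝟙 (P? (f i))
length-filter-tabulate {zero}  P? f = refl
length-filter-tabulate {suc n} P? f with does (P? (f zero))
... | true  = cong (_+_ 1ℤ) (length-filter-tabulate P? (f ∘ suc))
... | false = trans (length-filter-tabulate P? (f ∘ suc)) (sym (ℤ.+-identityˡ _))

δ-refl : (x : Fin n) → δ x x ≡ 1ℤ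
δ-refl x = 𝟙-yes (x Fin.≟ x) refl

δ-sym : (x y : Fin n) → δ x y ≡ δ y x
δ-sym x y with x Fin.≟ y
... | yes refl = sym (δ-refl x)
... | no x≢y = sym (𝟙-no (y Fin.≟ x) (x≢y ∘ sym))

∑-distrib-- : ∀ n (f g : Fin n → ℤ) → ∑[ x < n ] (f x - g x) ≡ sum f - sum g
∑-distrib-- zero    f g = refl
∑-distrib-- (suc n) f g = trans (cong (_+_ (f zero - g zero)) (∑-distrib-- n (f ∘ suc) (g ∘ suc)))
  (rearrange (f zero) (g zero) (sum (f ∘ suc)) (sum (g ∘ suc)))
  where
  rearrange : ∀ a b s t → a - b + (s - t) ≡ (a + s) - (b + t)
  rearrange = solve-∀

sum-nonneg : (f : Fin n → ℤ) → (∀ x → 0ℤ ≤ f x) → 0ℤ ≤ sum f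
sum-nonneg {zero}  f 0≤f = ℤ.≤-refl
sum-nonneg {suc n} f 0≤f = ℤ.+-mono-≤ (0≤f zero) (sum-nonneg (f ∘ suc) (0≤f ∘ suc))

+≡0⇒≡0 : ∀ {i j} → 0ℤ ≤ i → 0ℤ ≤ j → i + j ≡ 0ℤ → i ≡ 0ℤ × j ≡ 0ℤ
+≡0⇒≡0 {i} {j} 0≤i 0≤j i+j≡0 =
    ℤ.≤-antisym (subst (_≤ 0ℤ) (ℤ.+-identityʳ i) (ℤ.≤-trans (ℤ.+-monoʳ-≤ i 0≤j) (ℤ.≤-reflexive i+j≡0))) 0≤i
  , ℤ.≤-antisym (subst (_≤ 0ℤ) (ℤ.+-identityˡ j) (ℤ.≤-trans (ℤ.+-monoˡ-≤ j 0≤i) (ℤ.≤-reflexive i+j≡0))) 0≤j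

sum-nonneg-≡0 : (f : Fin n → ℤ) → (∀ x → 0ℤ ≤ f x) → sum f ≡ 0ℤ → ∀ x → f x ≡ 0ℤ
sum-nonneg-≡0 f 0≤f ∑≡0 zero    = proj₁ (+≡0⇒≡0 (0≤f zero) (sum-nonneg (f ∘ suc) (0≤f ∘ suc)) ∑≡0)
sum-nonneg-≡0 f 0≤f ∑≡0 (suc x) = sum-nonneg-≡0 (f ∘ suc) (0≤f ∘ suc)
  (proj₂ (+≡0⇒≡0 (0≤f zero) (sum-nonneg (f ∘ suc) (0≤f ∘ suc)) ∑≡0)) x

-- Sums over words and cyclic rotation

-- The sum of f over all words of length k with letters in Fin n.
∑ʷ : (k : ℕ) → (List (Fin n) → ℤ) → ℤ
∑ʷ         zero    f = f []
∑ʷ {n = n} (suc k) f = ∑[ x < n ] ∑ʷ k (λ w → f (x ∷ w))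

∑ʷ-cong : ∀ k {f g : List (Fin n) → ℤ} → (∀ w → length w ≡ k → f w ≡ g w) → ∑ʷ k f ≡ ∑ʷ k g
∑ʷ-cong zero    f≗g = f≗g [] refl
∑ʷ-cong (suc k) f≗g = sum-cong-≗ λ x → ∑ʷ-cong k λ w |w|≡k → f≗g (x ∷ w) (cong suc |w|≡k)

∑ʷ-∑-comm : ∀ k {m} (f : List (Fin n) → Fin m → ℤ) →
            ∑ʷ k (λ w → ∑[ j < m ] f w j) ≡ ∑[ j < m ] ∑ʷ k (λ w → f w j)
∑ʷ-∑-comm         zero    f = refl
∑ʷ-∑-comm {n = n} (suc k) {m} f = trans
  (sum-cong-≗ λ x → ∑ʷ-∑-comm k λ w → f (x ∷ w))
  (∑-comm {n} {m} λ x j → ∑ʷ k (λ w → f (x ∷ w) j))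

*-distribˡ-∑ʷ : ∀ k c (f : List (Fin n) → ℤ) → c * ∑ʷ k f ≡ ∑ʷ k (λ w → c * f w)
*-distribˡ-∑ʷ zero    c f = refl
*-distribˡ-∑ʷ {n = n} (suc k) c f =
  trans (*-distribˡ-sum {n} c _) (sum-cong-≗ λ x → *-distribˡ-∑ʷ k c λ w → f (x ∷ w))

-- Move the first letter to the end.
rotate : {A : Set} → List A → List A
rotate []      = []
rotate (x ∷ w) = w ++ [ x ]

module _ {A : Set} where

  length-rotate : (w : List A) → length (rotate w) ≡ length w
  length-rotate []      = refl
  length-rotate (x ∷ w) = trans (List.length-++ w) (ℕ.+-comm (length w) 1)

  rotate^ : ℕ → List A → List A
  rotate^ j w = fold w rotate j

  length-rotate^ : ∀ j (w : List A) → length (rotate^ j w) ≡ length w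
  length-rotate^ zero    w = refl
  length-rotate^ (suc j) w = trans (length-rotate (rotate^ j w)) (length-rotate^ j w)

  rotate^-+ : ∀ i j (w : List A) → rotate^ i (rotate^ j w) ≡ rotate^ (i ℕ.+ j) w
  rotate^-+ i j w = sym (fold-+ w rotate i)

  rotate^-++ : (u v : List A) → rotate^ (length u) (u ++ v) ≡ v ++ u
  rotate^-++ []      v = sym (List.++-identityʳ v)
  rotate^-++ (x ∷ u) v = begin
    rotate^ (suc (length u)) (x ∷ u ++ v)  ≡⟨ cong (λ j → rotate^ j (x ∷ u ++ v)) (ℕ.+-comm 1 (length u)) ⟩
    rotate^ (length u ℕ.+ 1) (x ∷ u ++ v)  ≡⟨ rotate^-+ (length u) 1 (x ∷ u ++ v) ⟨
    rotate^ (length u) ((u ++ v) ++ [ x ]) ≡⟨ cong (rotate^ (length u)) (List.++-assoc u v [ x ]) ⟩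
    rotate^ (length u) (u ++ v ++ [ x ])   ≡⟨ rotate^-++ u (v ++ [ x ]) ⟩
    (v ++ [ x ]) ++ u                      ≡⟨ List.++-assoc v [ x ] u ⟩
    v ++ x ∷ u                             ∎
    where open ≡-Reasoning

  rotate^-length : (w : List A) → rotate^ (length w) w ≡ w
  rotate^-length w = trans (cong (rotate^ (length w)) (sym (List.++-identityʳ w))) (rotate^-++ w [])

  rotate^-* : ∀ {m} {w : List A} → rotate^ m w ≡ w → ∀ q → rotate^ (q ℕ.* m) w ≡ w
  rotate^-*         eq zero    = refl
  rotate^-* {m} {w} eq (suc q) = begin
    rotate^ (m ℕ.+ q ℕ.* m) w       ≡⟨ rotate^-+ m (q ℕ.* m) w ⟨
    rotate^ m (rotate^ (q ℕ.* m) w) ≡⟨ cong (rotate^ m) (rotate^-* eq q) ⟩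
    rotate^ m w                     ≡⟨ eq ⟩
    w                               ∎
    where open ≡-Reasoning

  -- Only the residue of the number of rotations modulo the length matters.
  rotate^-% : ∀ {p} .{{_ : NonZero p}} {w : List A} → length w ≡ p →
              ∀ j → rotate^ j w ≡ rotate^ (j % p) w
  rotate^-% {p} {w} refl j = begin
    rotate^ j w                               ≡⟨ cong (λ i → rotate^ i w) (m≡m%n+[m/n]*n j p) ⟩
    rotate^ (j % p ℕ.+ j / p ℕ.* p) w         ≡⟨ rotate^-+ (j % p) (j / p ℕ.* p) w ⟨
    rotate^ (j % p) (rotate^ (j / p ℕ.* p) w) ≡⟨ cong (rotate^ (j % p)) (rotate^-* (rotate^-length w) (j / p)) ⟩
    rotate^ (j % p) w                         ∎
    where open ≡-Reasoning

-- Rotation permutes the words of a given length.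
∑ʷ-rotate : ∀ k (f : List (Fin n) → ℤ) → ∑ʷ k (f ∘ rotate) ≡ ∑ʷ k f
∑ʷ-rotate zero    f = refl
∑ʷ-rotate (suc k) f = last k f
  where
  last : ∀ k (f : List (Fin n) → ℤ) → ∑[ x < n ] ∑ʷ k (λ w → f (w ++ [ x ])) ≡ ∑ʷ (suc k) f
  last zero    f = refl
  last {n} (suc k) f = trans
    (∑-comm {n} {n} λ x y → ∑ʷ k (λ w → f (y ∷ w ++ [ x ])))
    (sum-cong-≗ λ y → last k (λ w → f (y ∷ w)))

∑ʷ-rotate^ : ∀ k j (f : List (Fin n) → ℤ) → ∑ʷ k (f ∘ rotate^ j) ≡ ∑ʷ k f
∑ʷ-rotate^ k zero    f = refl
∑ʷ-rotate^ k (suc j) f = trans (∑ʷ-rotate^ k j (f ∘ rotate)) (∑ʷ-rotate k f)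

module _ {A : Set} {p : ℕ} (p-prime : Prime p) {w : List A} (|w|≡p : length w ≡ p) where

  private instance
    p≢0 : NonZero p
    p≢0 = prime⇒nonZero p-prime

  rotate^p : rotate^ p w ≡ w
  rotate^p = subst (λ j → rotate^ j w ≡ w) |w|≡p (rotate^-length w)

  -- By Bézout, a single rotation is a power of the rotation by m, up to full
  -- turns.
  rotate-fixed : ∀ m .{{_ : NonZero m}} → m ℕ.< p → rotate^ m w ≡ w → rotate w ≡ w
  rotate-fixed m m<p eq with coprime-Bézout (prime⇒coprime p-prime m<p)
  ... | Bézout.+- x y 1+ym≡xp = begin
    rotate w                          ≡⟨ cong rotate (rotate^-* eq y) ⟨
    rotate^ (suc (y ℕ.* m)) w         ≡⟨ cong (λ j → rotate^ j w) 1+ym≡xp ⟩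
    rotate^ (x ℕ.* p) w               ≡⟨ rotate^-* rotate^p x ⟩
    w                                 ∎
    where open ≡-Reasoning
  ... | Bézout.-+ x y 1+xp≡ym = begin
    rotate w                          ≡⟨ cong rotate (rotate^-* rotate^p x) ⟨
    rotate^ (suc (x ℕ.* p)) w         ≡⟨ cong (λ j → rotate^ j w) 1+xp≡ym ⟩
    rotate^ (y ℕ.* m) w               ≡⟨ rotate^-* eq y ⟩
    w                                 ∎
    where open ≡-Reasoning

  -- If two rotations of w agree, rotating both by p - i shows that w is fixed by
  -- the rotation by j - i.
  rotate^-injective-< : rotate w ≢ w → ∀ {i j} → i ℕ.< j → j ℕ.< p → rotate^ i w ≢ rotate^ j w
  rotate^-injective-< aper {i} {j} i<j j<p eq = aper (rotate-fixed (j ℕ.∸ i) {{ℕ.>-nonZero (ℕ.m<n⇒0<n∸m i<j)}}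
     (ℕ.≤-<-trans (ℕ.m∸n≤m j i) j<p) (begin
    rotate^ (j ℕ.∸ i) w                                 ≡⟨ cong (rotate^ (j ℕ.∸ i)) rotate^p ⟨
    rotate^ (j ℕ.∸ i) (rotate^ p w)                     ≡⟨ rotate^-+ (j ℕ.∸ i) p w ⟩
    rotate^ (j ℕ.∸ i ℕ.+ p) w                           ≡⟨ cong (λ h → rotate^ h w) shift ⟩
    rotate^ ((p ℕ.∸ i) ℕ.+ j) w                         ≡⟨ rotate^-+ (p ℕ.∸ i) j w ⟨
    rotate^ (p ℕ.∸ i) (rotate^ j w)                     ≡⟨ cong (rotate^ (p ℕ.∸ i)) eq ⟨
    rotate^ (p ℕ.∸ i) (rotate^ i w)                     ≡⟨ rotate^-+ (p ℕ.∸ i) i w ⟩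
    rotate^ (p ℕ.∸ i ℕ.+ i) w                           ≡⟨ cong (λ h → rotate^ h w) (ℕ.m∸n+n≡m i≤p) ⟩
    rotate^ p w                                         ≡⟨ rotate^p ⟩
    w                                                   ∎))
    where
    open ≡-Reasoning
    i≤p : i ℕ.≤ p
    i≤p = ℕ.<⇒≤ (ℕ.<-trans i<j j<p)
    shift : j ℕ.∸ i ℕ.+ p ≡ (p ℕ.∸ i) ℕ.+ j
    shift = trans (sym (ℕ.+-∸-comm p (ℕ.<⇒≤ i<j))) (trans (cong (ℕ._∸ i) (ℕ.+-comm j p)) (ℕ.+-∸-comm j i≤p))

  rotate^-injective : rotate w ≢ w → ∀ {i j : Fin p} → rotate^ (toℕ i) w ≡ rotate^ (toℕ j) w → i ≡ j
  rotate^-injective aper {i} {j} eq with ℕ.<-cmp (toℕ i) (toℕ j)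
  ... | tri< i<j _ _ = contradiction eq (rotate^-injective-< aper i<j (Fin.toℕ<n j))
  ... | tri≈ _ i≡j _ = Fin.toℕ-injective i≡j
  ... | tri> _ _ j<i = contradiction (sym eq) (rotate^-injective-< aper j<i (Fin.toℕ<n i))

-- The lexicographic order on words singles out one rotation of each word.
lexOrder : ℕ → DecTotalOrder _ _ _
lexOrder n = Lex.≤-decTotalOrder (Fin.≤-decTotalOrder n)

module _ {n p : ℕ} (p-prime : Prime p) where

  open DecTotalOrder (lexOrder n) using (totalOrder)
    renaming (_≤_ to _≼_; _≤?_ to _≼?_; antisym to ≼-antisym)

  private instance
    p≢0 : NonZero p
    p≢0 = prime⇒nonZero p-prime

  -- The word w is lexicographically least among its rotations.
  IsLeast : List (Fin n) → Set
  IsLeast w = ∀ (i : Fin p) → w ≼ rotate^ (toℕ i) w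

  isLeast? : ∀ w → Dec (IsLeast w)
  isLeast? w = Fin.all? λ i → w ≼? rotate^ (toℕ i) w

  module _ {w : List (Fin n)} (|w|≡p : length w ≡ p) where

    private
      r : Fin p → List (Fin n)
      r i = rotate^ (toℕ i) w

    -- Every rotation is a rotation by less than p.
    rotate^-≡ : ∀ j → Σ[ i ∈ Fin p ] rotate^ j w ≡ r i
    rotate^-≡ j = fromℕ< (m%n<n j p) ,
      trans (rotate^-% |w|≡p j) (cong (λ h → rotate^ h w) (sym (Fin.toℕ-fromℕ< (m%n<n j p))))

    -- An amount of rotation that makes w least.
    least : Fin p
    least = Extrema.argmin totalOrder r (fromℕ< (ℕ.>-nonZero⁻¹ p)) (allFin p)

    least-≼ : ∀ i → r least ≼ r i
    least-≼ i = All.lookup (Extrema.f[argmin]≤f[xs] totalOrder {f = r} _ (allFin p)) (∈-allFin i)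

    least-isLeast : IsLeast (r least)
    least-isLeast i with rotate^-≡ (toℕ i ℕ.+ toℕ least)
    ... | j , eq = subst (r least ≼_) (sym (trans (rotate^-+ (toℕ i) (toℕ least) w) eq)) (least-≼ j)

    isLeast-≼ : ∀ {j} → IsLeast (r j) → ∀ i → r j ≼ r i
    isLeast-≼ {j} rj-least i = subst (r j ≼_) eq (rj-least h)
      where
      open ≡-Reasoning
      -- Rotating by h leads from r j to r i: the total i + (p - j) + j is i
      -- plus one full turn.
      e = toℕ i ℕ.+ (p ℕ.∸ toℕ j)
      h : Fin p
      h = fromℕ< (m%n<n e p)
      turn : e ℕ.+ toℕ j ≡ toℕ i ℕ.+ p
      turn = trans (ℕ.+-assoc (toℕ i) (p ℕ.∸ toℕ j) (toℕ j))
                   (cong (toℕ i ℕ.+_) (ℕ.m∸n+n≡m (ℕ.<⇒≤ (Fin.toℕ<n j))))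
      eq : rotate^ (toℕ h) (r j) ≡ r i
      eq = begin
        rotate^ (toℕ h) (r j)         ≡⟨ cong (λ k → rotate^ k (r j)) (Fin.toℕ-fromℕ< (m%n<n e p)) ⟩
        rotate^ (e % p) (r j)         ≡⟨ rotate^-% (trans (length-rotate^ (toℕ j) w) |w|≡p) e ⟨
        rotate^ e (r j)               ≡⟨ rotate^-+ e (toℕ j) w ⟩
        rotate^ (e ℕ.+ toℕ j) w       ≡⟨ cong (λ k → rotate^ k w) turn ⟩
        rotate^ (toℕ i ℕ.+ p) w       ≡⟨ rotate^-+ (toℕ i) p w ⟨
        rotate^ (toℕ i) (rotate^ p w) ≡⟨ cong (rotate^ (toℕ i)) (rotate^p p-prime |w|≡p) ⟩
        r i                           ∎

    isLeast-unique : rotate w ≢ w → ∀ j → 𝟙 (isLeast? (r j)) ≡ δ least j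
    isLeast-unique aper j with least Fin.≟ j
    ... | yes refl = 𝟙-yes (isLeast? (r j)) least-isLeast
    ... | no least≢j = 𝟙-no (isLeast? (r j)) λ rj-least → least≢j
      (rotate^-injective p-prime |w|≡p aper (Pointwise-≡⇒≡ (≼-antisym (least-≼ j) (isLeast-≼ {j} rj-least least))))

    -- If w is not fixed by rotation, exactly one of its p rotations is least.
    ∑-isLeast : rotate w ≢ w → ∑[ j < p ] 𝟙 (isLeast? (r j)) ≡ 1ℤ
    ∑-isLeast aper = begin
      ∑[ j < p ] 𝟙 (isLeast? (r j))  ≡⟨ sum-cong-≗ (λ j → trans (isLeast-unique aper j) (sym (ℤ.*-identityʳ _))) ⟩
      ∑[ j < p ] (δ least j * 1ℤ)    ≡⟨ sum-δ least (λ _ → 1ℤ) ⟩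
      1ℤ                             ∎
      where open ≡-Reasoning

  -- Let f be rotation invariant and vanish on words fixed by rotation. All other
  -- orbits have p elements, so p divides the sum of f: the quotient is the sum
  -- over the least words of the orbits.
  module _ (f : List (Fin n) → ℤ) (f-rotate : ∀ w → f (rotate w) ≡ f w)
           (f-fixed : ∀ w → length w ≡ p → rotate w ≡ w → f w ≡ 0ℤ) where

    f-rotate^ : ∀ j w → f (rotate^ j w) ≡ f w
    f-rotate^ zero    w = refl
    f-rotate^ (suc j) w = trans (f-rotate (rotate^ j w)) (f-rotate^ j w)

    f·isLeast : List (Fin n) → ℤ
    f·isLeast w = f w * 𝟙 (isLeast? w)

    -- Only the least of the p rotations of w contributes to the sum, unless w is
    -- fixed by rotation, when all terms vanish.
    f-split : ∀ w → length w ≡ p → f w ≡ ∑[ j < p ] f·isLeast (rotate^ (toℕ j) w)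
    f-split w |w|≡p = begin
      f w                                        ≡⟨ one-least ⟩
      f w * sum least#                           ≡⟨ *-distribˡ-sum {p} (f w) least# ⟩
      ∑[ j < p ] (f w * least# j)                ≡⟨ sum-cong-≗ {p} (λ j → cong (_* least# j) (sym (f-rotate^ (toℕ j) w))) ⟩
      ∑[ j < p ] f·isLeast (rotate^ (toℕ j) w)   ∎
      where
      open ≡-Reasoning
      least# : Fin p → ℤ
      least# j = 𝟙 (isLeast? (rotate^ (toℕ j) w))

      one-least : f w ≡ f w * sum least#
      one-least with List.≡-dec Fin._≟_ (rotate w) w
      ... | yes fixed = trans fw≡0 (sym (trans (cong (_* sum least#) fw≡0) (ℤ.*-zeroˡ (sum least#))))
        where fw≡0 = f-fixed w |w|≡p fixed
      ... | no aper = sym (trans (cong (f w *_) (∑-isLeast |w|≡p aper)) (ℤ.*-identityʳ (f w)))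

    ∑ʷ-divisible : ∃[ q ] ∑ʷ p f ≡ + p * q
    ∑ʷ-divisible = ∑ʷ p f·isLeast , (begin
      ∑ʷ p f                                                 ≡⟨ ∑ʷ-cong p f-split ⟩
      ∑ʷ p (λ w → ∑[ j < p ] f·isLeast (rotate^ (toℕ j) w))  ≡⟨ ∑ʷ-∑-comm p {p} (λ w j → f·isLeast (rotate^ (toℕ j) w)) ⟩
      ∑[ j < p ] ∑ʷ p (f·isLeast ∘ rotate^ (toℕ j))          ≡⟨ sum-cong-≗ {p} (λ j → ∑ʷ-rotate^ p (toℕ j) f·isLeast) ⟩
      ∑[ j < p ] ∑ʷ p f·isLeast                              ≡⟨ sum-const p (∑ʷ p f·isLeast) ⟩
      + p * ∑ʷ p f·isLeast                                   ∎)
      where open ≡-Reasoning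

-- Degrees and codegrees in a graph and its complement

-- The adjacency matrix, with entries 0 and 1.
adj : Graph n → Fin n → Fin n → ℤ
adj G x y = 𝟙 (adj? G x y)

degree : Graph n → Fin n → ℤ
degree {n} G x = ∑[ z < n ] adj G x z

-- The number of common neighbours of x and y; the symmetry of the adjacency
-- matrix makes this the (x , y) entry of its square.
codegree : Graph n → Fin n → Fin n → ℤ
codegree {n} G x y = ∑[ z < n ] (adj G x z * adj G y z)

codegree-length : (G : Graph n) (x y : Fin n) → + length (commonNeighbours G x y) ≡ codegree G x y
codegree-length G x y = trans (length-filter-tabulate (λ z → adj? G x z ×-dec adj? G y z) id)
  (sum-cong-≗ λ z → 𝟙-× (adj? G x z) (adj? G y z))

module _ (G : Graph n) where

  adj-symmetric : ∀ x y → adj G x y ≡ adj G y x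
  adj-symmetric x y with adj? G x y
  ... | yes xy = sym (𝟙-yes (adj? G y x) (adj-sym G xy))
  ... | no ¬xy = sym (𝟙-no (adj? G y x) (¬xy ∘ adj-sym G))

  adj-diagonal : ∀ x → adj G x x ≡ 0ℤ
  adj-diagonal x = 𝟙-no (adj? G x x) (irrefl G refl)

  codegree-diagonal : ∀ x → codegree G x x ≡ degree G x
  codegree-diagonal x = sum-cong-≗ λ z → 𝟙-idem (adj? G x z)

  adj-complement : ∀ x y → adj (complement G) x y ≡ 1ℤ - δ x y - adj G x y
  adj-complement x y with x Fin.≟ y | adj? G x y
  ... | yes x≡y | yes xy = contradiction xy (irrefl G x≡y)
  ... | yes _   | no  _  = refl
  ... | no  _   | yes _  = refl
  ... | no  _   | no  _  = refl

  ∑-complement : ∀ x (f : Fin n → ℤ) →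
    ∑[ z < n ] (adj (complement G) x z * f z) ≡ sum f - f x - ∑[ z < n ] (adj G x z * f z)
  ∑-complement x f = begin
    ∑[ z < n ] (adj (complement G) x z * f z)
      ≡⟨ sum-cong-≗ (λ z → trans (cong (_* f z) (adj-complement x z)) (expand (δ x z) (adj G x z) (f z))) ⟩
    ∑[ z < n ] (f z - δ x z * f z - adj G x z * f z)
      ≡⟨ ∑-distrib-- n (λ z → f z - δ x z * f z) (λ z → adj G x z * f z) ⟩
    ∑[ z < n ] (f z - δ x z * f z) - ∑[ z < n ] (adj G x z * f z)
      ≡⟨ cong (_- ∑[ z < n ] (adj G x z * f z)) (∑-distrib-- n f (λ z → δ x z * f z)) ⟩
    sum f - ∑[ z < n ] (δ x z * f z) - ∑[ z < n ] (adj G x z * f z)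
      ≡⟨ cong (λ t → sum f - t - ∑[ z < n ] (adj G x z * f z)) (sum-δ x f) ⟩
    sum f - f x - ∑[ z < n ] (adj G x z * f z) ∎
    where
    open ≡-Reasoning
    expand : ∀ d a t → (1ℤ - d - a) * t ≡ t - d * t - a * t
    expand = solve-∀

  degree-complement : ∀ x → degree (complement G) x ≡ + n - 1ℤ - degree G x
  degree-complement x = begin
    ∑[ z < n ] adj (complement G) x z         ≡⟨ sum-cong-≗ (λ z → sym (ℤ.*-identityʳ (adj (complement G) x z))) ⟩
    ∑[ z < n ] (adj (complement G) x z * 1ℤ)  ≡⟨ ∑-complement x (λ _ → 1ℤ) ⟩
    ∑[ z < n ] 1ℤ - 1ℤ - ∑[ z < n ] (adj G x z * 1ℤ)
      ≡⟨ cong₂ (λ s t → s - 1ℤ - t) (trans (sum-const n 1ℤ) (ℤ.*-identityʳ (+ n)))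
                                        (sum-cong-≗ λ z → ℤ.*-identityʳ (adj G x z)) ⟩
    + n - 1ℤ - degree G x ∎
    where open ≡-Reasoning

  codegree-complement : ∀ x y → codegree (complement G) x y ≡
    + n - 1ℤ - degree G y - adj (complement G) y x - (degree G x - adj G x y - codegree G x y)
  codegree-complement x y = begin
    codegree (complement G) x y
      ≡⟨ ∑-complement x (adj (complement G) y) ⟩
    degree (complement G) y - adj (complement G) y x - ∑[ z < n ] (adj G x z * adj (complement G) y z)
      ≡⟨ cong₂ (λ s t → s - adj (complement G) y x - t) (degree-complement y)
               (sum-cong-≗ λ z → ℤ.*-comm (adj G x z) (adj (complement G) y z)) ⟩
    + n - 1ℤ - degree G y - adj (complement G) y x - ∑[ z < n ] (adj (complement G) y z * adj G x z)
      ≡⟨ cong (λ t → + n - 1ℤ - degree G y - adj (complement G) y x - t) mixed ⟩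
    + n - 1ℤ - degree G y - adj (complement G) y x - (degree G x - adj G x y - codegree G x y) ∎
    where
    open ≡-Reasoning
    mixed : ∑[ z < n ] (adj (complement G) y z * adj G x z) ≡ degree G x - adj G x y - codegree G x y
    mixed = trans (∑-complement y (adj G x))
      (cong (_-_ (degree G x - adj G x y)) (sum-cong-≗ λ z → ℤ.*-comm (adj G y z) (adj G x z)))

  -- The sum of the degrees of the neighbours of x.
  degreeSum : Fin n → ℤ
  degreeSum x = ∑[ y < n ] (adj G x y * degree G y)

  ∑-codegree : ∀ x → ∑[ y < n ] codegree G x y ≡ degreeSum x
  ∑-codegree x = begin
    ∑[ y < n ] ∑[ z < n ] (adj G x z * adj G y z)
      ≡⟨ ∑-comm {n} {n} (λ y z → adj G x z * adj G y z) ⟩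
    ∑[ z < n ] ∑[ y < n ] (adj G x z * adj G y z)
      ≡⟨ sum-cong-≗ (λ z → sym (*-distribˡ-sum {n} (adj G x z) (λ y → adj G y z))) ⟩
    ∑[ z < n ] (adj G x z * ∑[ y < n ] adj G y z)
      ≡⟨ sum-cong-≗ (λ z → cong (adj G x z *_) (sum-cong-≗ λ y → adj-symmetric y z)) ⟩
    degreeSum x ∎
    where open ≡-Reasoning

  ∑-degreeSum : sum degreeSum ≡ ∑[ x < n ] (degree G x * degree G x)
  ∑-degreeSum = begin
    ∑[ x < n ] ∑[ y < n ] (adj G x y * degree G y)
      ≡⟨ ∑-comm {n} {n} (λ x y → adj G x y * degree G y) ⟩
    ∑[ y < n ] ∑[ x < n ] (adj G x y * degree G y)
      ≡⟨ sum-cong-≗ (λ y → sym (*-distribʳ-sum {n} (degree G y) (λ x → adj G x y))) ⟩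
    ∑[ y < n ] ((∑[ x < n ] adj G x y) * degree G y)
      ≡⟨ sum-cong-≗ (λ y → cong (_* degree G y) (sum-cong-≗ λ x → adj-symmetric x y)) ⟩
    ∑[ y < n ] (degree G y * degree G y) ∎
    where open ≡-Reasoning

-- Goodman's count on 37 vertices

-- The value at d = 18 + e of the product (3d - 52)(d - 18) is (3e + 2) e, a
-- natural number m that vanishes only for e = 0.
quadratic : ∀ e → ∃[ m ] (+ 3 * e + + 2) * e ≡ + m × (m ≡ 0 → e ≡ 0ℤ)
quadratic (+ k) = (3 ℕ.* k ℕ.+ 2) ℕ.* k , eq , zero-case k
  where
  eq : (+ 3 * + k + + 2) * + k ≡ + ((3 ℕ.* k ℕ.+ 2) ℕ.* k)
  eq = trans (cong (λ t → (t + + 2) * + k) (sym (ℤ.pos-* 3 k))) (sym (ℤ.pos-* (3 ℕ.* k ℕ.+ 2) k))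
  zero-case : ∀ k → (3 ℕ.* k ℕ.+ 2) ℕ.* k ≡ 0 → + k ≡ 0ℤ
  zero-case zero    _ = refl
  zero-case (suc k) ()
quadratic -[1+ k ] = suc (3 ℕ.* k) ℕ.* suc k , eq , λ ()
  where
  rearrange : ∀ t → (+ 3 * - (1ℤ + t) + + 2) * - (1ℤ + t) ≡ (1ℤ + + 3 * t) * (1ℤ + t)
  rearrange = solve-∀
  eq : (+ 3 * -[1+ k ] + + 2) * -[1+ k ] ≡ + (suc (3 ℕ.* k) ℕ.* suc k)
  eq = trans (rearrange (+ k)) (trans (cong (λ t → (1ℤ + t) * (1ℤ + + k)) (sym (ℤ.pos-* 3 k)))
                                 (sym (ℤ.pos-* (suc (3 ℕ.* k)) (suc k))))

-- A graph on 37 vertices with red codegrees at most 7 and blue codegrees at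
-- most 9. The number of vertices is a variable n subject to n ≡ 37, so that
-- sums over the vertices stay symbolic.
module Extremal (n≡37 : n ≡ 37) (G : Graph n)
  (red  : ∀ x y → Adj G x y → codegree G x y ≤ + 7)
  (blue : ∀ x y → Adj (complement G) x y → codegree (complement G) x y ≤ + 9) where

  private
    a = adj G
    d = degree G
    c = codegree G
    a′ = adj (complement G)
    c′ = codegree (complement G)
    N = degreeSum G
    D = sum d

    ∑-const : ∀ c → ∑[ x < n ] c ≡ + 37 * c
    ∑-const c = trans (sum-const n c) (cong (λ m → + m * c) n≡37)

  -- The slack in the codegree bound for x and y, as one expression: it equals
  -- 7 minus the codegree on edges, 9 minus the codegree in the complement on
  -- nonedges, and 0 on the diagonal.
  slack : Fin n → Fin n → ℤ
  slack x y = d x + d y - + 26 - c x y + δ x y * (+ 26 - d x) + a x y * (+ 33 - d x - d y)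

  -- The product (3d - 52)(d - 18) for the degree d of x.
  excess : Fin n → ℤ
  excess x = (+ 3 * (d x - + 18) + + 2) * (d x - + 18)

  slack-nonneg : ∀ x y → 0ℤ ≤ slack x y
  slack-nonneg x y = case x Fin.≟ y of λ where
      (yes refl) → ℤ.≤-reflexive (sym
        (diagonal (d x) (c x x) (δ x x) (a x x) (codegree-diagonal G x) (δ-refl x) (adj-diagonal G x)))
      (no x≢y) → case adj? G x y of λ where
        (yes xy) → subst (0ℤ ≤_)
          (sym (edge (d x) (d y) (c x y) (δ x y) (a x y) (𝟙-no (x Fin.≟ y) x≢y) (𝟙-yes (adj? G x y) xy)))
          (ℤ.i≤j⇒0≤j-i (red x y xy))
        (no ¬xy) → subst (0ℤ ≤_)
          (sym (nonEdge (d x) (d y) (c x y) (δ x y) (a x y) (a′ y x) (c′ x y)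
            (𝟙-no (x Fin.≟ y) x≢y) (𝟙-no (adj? G x y) ¬xy)
            (𝟙-yes (adj? (complement G) y x) (adj-sym (complement G) (x≢y , ¬xy)))
            (trans (codegree-complement G x y)
                   (cong (λ m → + m - 1ℤ - d y - a′ y x - (d x - a x y - c x y)) n≡37))))
          (ℤ.i≤j⇒0≤j-i (blue x y (x≢y , ¬xy)))
    where
    diagonal : ∀ d c δ a → c ≡ d → δ ≡ 1ℤ → a ≡ 0ℤ → d + d - + 26 - c + δ * (+ 26 - d) + a * (+ 33 - d - d) ≡ 0ℤ
    diagonal d _ _ _ refl refl refl = lemma d
      where
      lemma : ∀ d → d + d - + 26 - d + 1ℤ * (+ 26 - d) + 0ℤ * (+ 33 - d - d) ≡ 0ℤ
      lemma = solve-∀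
    edge : ∀ d e c δ a → δ ≡ 0ℤ → a ≡ 1ℤ → d + e - + 26 - c + δ * (+ 26 - d) + a * (+ 33 - d - e) ≡ + 7 - c
    edge d e c _ _ refl refl = lemma d e c
      where
      lemma : ∀ d e c → d + e - + 26 - c + 0ℤ * (+ 26 - d) + 1ℤ * (+ 33 - d - e) ≡ + 7 - c
      lemma = solve-∀
    nonEdge : ∀ d e c δ a b c′ → δ ≡ 0ℤ → a ≡ 0ℤ → b ≡ 1ℤ → c′ ≡ + 37 - 1ℤ - e - b - (d - a - c) →
              d + e - + 26 - c + δ * (+ 26 - d) + a * (+ 33 - d - e) ≡ + 9 - c′
    nonEdge d e c _ _ _ _ refl refl refl refl = lemma d e c
      where
      lemma : ∀ d e c → d + e - + 26 - c + 0ℤ * (+ 26 - d) + 0ℤ * (+ 33 - d - e)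
                    ≡ + 9 - (+ 37 - 1ℤ - e - 1ℤ - (d - 0ℤ - c))
      lemma = solve-∀

  ∑-slack : ∀ x → ∑[ y < n ] slack x y
                ≡ + 37 * d x + D - + 37 * + 26 - N x + (+ 26 - d x) + (d x * (+ 33 - d x) - N x)
  ∑-slack x = begin
    ∑[ y < n ] slack x y
      ≡⟨ ∑-distrib-+ {n} (λ y → d x + d y - + 26 - c x y + δ x y * (+ 26 - d x))
                   (λ y → a x y * (+ 33 - d x - d y)) ⟩
    ∑[ y < n ] (d x + d y - + 26 - c x y + δ x y * (+ 26 - d x)) + ∑[ y < n ] (a x y * (+ 33 - d x - d y))
      ≡⟨ cong₂ _+_ (∑-distrib-+ {n} (λ y → d x + d y - + 26 - c x y) (λ y → δ x y * (+ 26 - d x))) neighbourPart ⟩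
    ∑[ y < n ] (d x + d y - + 26 - c x y) + ∑[ y < n ] (δ x y * (+ 26 - d x)) + A
      ≡⟨ cong₂ (λ s t → s + t + A) (∑-distrib-- n (λ y → d x + d y - + 26) (c x)) (sum-δ x (λ _ → + 26 - d x)) ⟩
    ∑[ y < n ] (d x + d y - + 26) - sum (c x) + (+ 26 - d x) + A
      ≡⟨ cong₂ (λ s t → s - t + (+ 26 - d x) + A) degreePart (∑-codegree G x) ⟩
    + 37 * d x + D - + 37 * + 26 - N x + (+ 26 - d x) + A ∎
    where
    open ≡-Reasoning
    A = d x * (+ 33 - d x) - N x
    neighbourPart : ∑[ y < n ] (a x y * (+ 33 - d x - d y)) ≡ A
    neighbourPart = begin
      ∑[ y < n ] (a x y * (+ 33 - d x - d y))
        ≡⟨ sum-cong-≗ (λ y → expand (a x y) (+ 33 - d x) (d y)) ⟩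
      ∑[ y < n ] (a x y * (+ 33 - d x) - a x y * d y)
        ≡⟨ ∑-distrib-- n (λ y → a x y * (+ 33 - d x)) (λ y → a x y * d y) ⟩
      ∑[ y < n ] (a x y * (+ 33 - d x)) - N x
        ≡⟨ cong (_- N x) (sym (*-distribʳ-sum {n} (+ 33 - d x) (a x))) ⟩
      A ∎
      where
      expand : ∀ a s t → a * (s - t) ≡ a * s - a * t
      expand = solve-∀
    degreePart : ∑[ y < n ] (d x + d y - + 26) ≡ + 37 * d x + D - + 37 * + 26
    degreePart = trans (∑-distrib-- n (λ y → d x + d y) (λ _ → + 26))
      (cong₂ _-_ (trans (∑-distrib-+ {n} (λ _ → d x) d) (cong (_+ D) (∑-const (d x)))) (∑-const (+ 26)))

  -- Goodman's count. Summed over x, the degree sums over neighbours turn into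
  -- squares of degrees, and all terms cancel.
  total : ∑[ x < n ] (∑[ y < n ] slack x y + excess x) ≡ 0ℤ
  total = begin
    ∑[ x < n ] (∑[ y < n ] slack x y + excess x)
      ≡⟨ sum-cong-≗ (λ x → trans (cong (_+ excess x) (∑-slack x)) (collect (d x) D (N x))) ⟩
    ∑[ x < n ] (D - + 37 * d x + + 2 * (d x * d x - N x))
      ≡⟨ ∑-distrib-+ {n} (λ x → D - + 37 * d x) (λ x → + 2 * (d x * d x - N x)) ⟩
    ∑[ x < n ] (D - + 37 * d x) + ∑[ x < n ] (+ 2 * (d x * d x - N x))
      ≡⟨ cong₂ _+_ linearPart squarePart ⟩
    (+ 37 * D - + 37 * D) + + 2 * (Q - Q)
      ≡⟨ cancel D Q ⟩
    0ℤ ∎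
    where
    open ≡-Reasoning
    Q = ∑[ x < n ] (d x * d x)
    linearPart : ∑[ x < n ] (D - + 37 * d x) ≡ + 37 * D - + 37 * D
    linearPart = trans (∑-distrib-- n (λ _ → D) (λ x → + 37 * d x))
      (cong₂ _-_ (∑-const D) (sym (*-distribˡ-sum {n} (+ 37) d)))
    squarePart : ∑[ x < n ] (+ 2 * (d x * d x - N x)) ≡ + 2 * (Q - Q)
    squarePart = trans (sym (*-distribˡ-sum {n} (+ 2) (λ x → d x * d x - N x)))
      (cong (+ 2 *_) (trans (∑-distrib-- n (λ x → d x * d x) N) (cong (_-_ Q) (∑-degreeSum G))))
    collect : ∀ d D N → + 37 * d + D - + 37 * + 26 - N + (+ 26 - d) + (d * (+ 33 - d) - N)
                        + (+ 3 * (d - + 18) + + 2) * (d - + 18)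
                      ≡ D - + 37 * d + + 2 * (d * d - N)
    collect = solve-∀
    cancel : ∀ D Q → (+ 37 * D - + 37 * D) + + 2 * (Q - Q) ≡ 0ℤ
    cancel = solve-∀

  excess-nonneg : ∀ x → 0ℤ ≤ excess x
  excess-nonneg x with quadratic (d x - + 18)
  ... | m , eq , _ = subst (0ℤ ≤_) (sym eq) (ℤ.+≤+ ℕ.z≤n)

  ∑slack-nonneg : ∀ x → 0ℤ ≤ ∑[ y < n ] slack x y
  ∑slack-nonneg x = sum-nonneg (slack x) (slack-nonneg x)

  tight : ∀ x → ∑[ y < n ] slack x y ≡ 0ℤ × excess x ≡ 0ℤ
  tight x = +≡0⇒≡0 (∑slack-nonneg x) (excess-nonneg x)
    (sum-nonneg-≡0 (λ x → ∑[ y < n ] slack x y + excess x)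
      (λ x → ℤ.+-mono-≤ (∑slack-nonneg x) (excess-nonneg x)) total x)

  regular : ∀ x → d x ≡ + 18
  regular x with quadratic (d x - + 18)
  ... | m , eq , m≡0⇒ = ℤ.i-j≡0⇒i≡j (d x) (+ 18) (m≡0⇒ (ℤ.+-injective (trans (sym eq) (proj₂ (tight x)))))

  -- In matrix form, A² = 8 I - 3 A + 10 J.
  codegree-value : ∀ x y → c x y ≡ + 10 + + 8 * δ x y - + 3 * a x y
  codegree-value x y = solveFor (d x) (d y) (c x y) (δ x y) (a x y) (regular x) (regular y)
    (sum-nonneg-≡0 (slack x) (slack-nonneg x) (proj₁ (tight x)) y)
    where
    solveFor : ∀ d e c δ a → d ≡ + 18 → e ≡ + 18 → d + e - + 26 - c + δ * (+ 26 - d) + a * (+ 33 - d - e) ≡ 0ℤ →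
               c ≡ + 10 + + 8 * δ - + 3 * a
    solveFor _ _ c δ a refl refl eq = sym (ℤ.i-j≡0⇒i≡j _ c (trans (lemma c δ a) eq))
      where
      lemma : ∀ c δ a → + 10 + + 8 * δ - + 3 * a - c
                      ≡ + 18 + + 18 - + 26 - c + δ * (+ 26 - + 18) + a * (+ 33 - + 18 - + 18)
      lemma = solve-∀

-- Closed walks

module _ (G : Graph n) where

  -- The 0/1 indicator that x, followed by the letters of a word, followed by y,
  -- is a walk.
  path : Fin n → List (Fin n) → Fin n → ℤ
  path x []      y = adj G x y
  path x (z ∷ w) y = adj G x z * path z w y

  -- The 0/1 indicator that a word, read cyclically, is a closed walk. The value
  -- 0 at the empty word is a default.
  closed : List (Fin n) → ℤ
  closed []      = 0ℤ
  closed (x ∷ w) = path x w x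

  path-∷ʳ : ∀ x w z y → path x (w ++ [ z ]) y ≡ path x w z * adj G z y
  path-∷ʳ x []      z y = refl
  path-∷ʳ x (v ∷ w) z y =
    trans (cong (adj G x v *_) (path-∷ʳ v w z y)) (sym (ℤ.*-assoc (adj G x v) (path v w z) (adj G z y)))

  closed-rotate : ∀ w → closed (rotate w) ≡ closed w
  closed-rotate []          = refl
  closed-rotate (x ∷ [])    = refl
  closed-rotate (x ∷ y ∷ w) = trans (path-∷ʳ y w x y) (ℤ.*-comm (path y w x) (adj G x y))

  -- A word fixed by rotation begins with a repeated letter, and there are no
  -- loops.
  closed-fixed : ∀ w → rotate w ≡ w → closed w ≡ 0ℤ
  closed-fixed []          _  = refl
  closed-fixed (x ∷ [])    _  = adj-diagonal G x
  closed-fixed (x ∷ y ∷ w) eq with List.∷-injectiveˡ eq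
  ... | refl = trans (cong (_* path x w x) (adj-diagonal G x)) (ℤ.*-zeroˡ (path x w x))

  prime∣closedWalks : ∀ {p} → Prime p → ∃[ q ] ∑ʷ p closed ≡ + p * q
  prime∣closedWalks p-prime = ∑ʷ-divisible p-prime closed closed-rotate (λ w _ → closed-fixed w)

  -- The number of walks from x to y with k inner vertices, that is, the (x , y)
  -- entry of the power k + 1 of the adjacency matrix.
  walks : ℕ → Fin n → Fin n → ℤ
  walks k x y = ∑ʷ k (λ w → path x w y)

  walks-suc : ∀ k x y → walks (suc k) x y ≡ ∑[ z < n ] (adj G x z * walks k z y)
  walks-suc k x y = sum-cong-≗ λ z → sym (*-distribˡ-∑ʷ k (adj G x z) (λ w → path z w y))

-- If A has row sums 18 and A² = 8 I - 3 A + 10 J, then the power k + 1 of A is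
-- α k I + β k A + γ k J.
α β γ : ℕ → ℤ
α zero    = 0ℤ
α (suc k) = + 8 * β k
β zero    = 1ℤ
β (suc k) = α k - + 3 * β k
γ zero    = 0ℤ
γ (suc k) = + 10 * β k + + 18 * γ k

α₆+γ₆ : α 6 + γ 6 ≡ + 16529526
α₆+γ₆ = refl

-- For 37 vertices, these are the strongly regular graphs with parameters
-- (37, 18, 7, 10).
module StronglyRegular (G : Graph n)
  (regular : ∀ x → degree G x ≡ + 18)
  (codegree-value : ∀ x y → codegree G x y ≡ + 10 + + 8 * δ x y - + 3 * adj G x y) where

  walks-formula : ∀ k x y → walks G k x y ≡ α k * δ x y + β k * adj G x y + γ k
  walks-formula zero    x y = base (δ x y) (adj G x y)
    where
    base : ∀ δ a → a ≡ 0ℤ * δ + 1ℤ * a + 0ℤ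
    base = solve-∀
  walks-formula (suc k) x y = begin
    walks G (suc k) x y
      ≡⟨ walks-suc G k x y ⟩
    ∑[ z < n ] (adj G x z * walks G k z y)
      ≡⟨ sum-cong-≗ (λ z → trans (cong (adj G x z *_) (step z))
                                 (expand (α k) (β k) (γ k) (adj G x z) (δ y z) (adj G y z))) ⟩
    ∑[ z < n ] (α k * I z + β k * S z + γ k * adj G x z)
      ≡⟨ ∑-distrib-+ {n} (λ z → α k * I z + β k * S z) (λ z → γ k * adj G x z) ⟩
    ∑[ z < n ] (α k * I z + β k * S z) + ∑[ z < n ] (γ k * adj G x z)
      ≡⟨ cong (_+ ∑[ z < n ] (γ k * adj G x z)) (∑-distrib-+ {n} (λ z → α k * I z) (λ z → β k * S z)) ⟩
    ∑[ z < n ] (α k * I z) + ∑[ z < n ] (β k * S z) + ∑[ z < n ] (γ k * adj G x z)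
      ≡⟨ cong₂ _+_ (cong₂ _+_ (trans (sym (*-distribˡ-sum {n} (α k) I)) (cong (α k *_) (sum-δ y (adj G x))))
                              (trans (sym (*-distribˡ-sum {n} (β k) S)) (cong (β k *_) (codegree-value x y))))
                   (trans (sym (*-distribˡ-sum {n} (γ k) (adj G x))) (cong (γ k *_) (regular x))) ⟩
    α k * adj G x y + β k * (+ 10 + + 8 * δ x y - + 3 * adj G x y) + γ k * + 18
      ≡⟨ collect (α k) (β k) (γ k) (δ x y) (adj G x y) ⟩
    + 8 * β k * δ x y + (α k - + 3 * β k) * adj G x y + (+ 10 * β k + + 18 * γ k) ∎
    where
    open ≡-Reasoning
    I S : Fin n → ℤ
    I z = δ y z * adj G x z
    S z = adj G x z * adj G y z
    step : ∀ z → walks G k z y ≡ α k * δ y z + β k * adj G y z + γ k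
    step z = trans (walks-formula k z y)
      (cong₂ (λ s t → α k * s + β k * t + γ k) (δ-sym z y) (adj-symmetric G z y))
    expand : ∀ α β γ s d t → s * (α * d + β * t + γ) ≡ α * (d * s) + β * (s * t) + γ * s
    expand = solve-∀
    collect : ∀ α β γ d a → α * a + β * (+ 10 + + 8 * d - + 3 * a) + γ * + 18
                          ≡ + 8 * β * d + (α - + 3 * β) * a + (+ 10 * β + + 18 * γ)
    collect = solve-∀

  closedWalks : ∀ k → ∑ʷ (suc k) (closed G) ≡ + n * (α k + γ k)
  closedWalks k = begin
    ∑[ x < n ] walks G k x x
      ≡⟨ sum-cong-≗ (λ x → trans (walks-formula k x x)
                                 (diagonal (α k) (β k) (γ k) (δ-refl x) (adj-diagonal G x))) ⟩
    ∑[ x < n ] (α k + γ k)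
      ≡⟨ sum-const n (α k + γ k) ⟩
    + n * (α k + γ k) ∎
    where
    open ≡-Reasoning
    diagonal : ∀ α β γ {d a} → d ≡ 1ℤ → a ≡ 0ℤ → α * d + β * a + γ ≡ α + γ
    diagonal α β γ refl refl = lemma α β γ
      where
      lemma : ∀ α β γ → α * 1ℤ + β * 0ℤ + γ ≡ α + γ
      lemma = solve-∀

  -- The trace of A⁷; closed walks of length 7 have six inner vertices between
  -- their first letter and its repetition.
  closed7Walks : n ≡ 37 → ∑ʷ 7 (closed G) ≡ + 37 * + 16529526
  closed7Walks n≡37 = trans (closedWalks 6) (cong₂ _*_ (cong +_ n≡37) α₆+γ₆)

  impossible : n ≢ 37
  impossible n≡37 = 7∤ (proj₁ multiple) (trans (sym (closed7Walks n≡37)) (proj₂ multiple))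
    where
    multiple : ∃[ q ] ∑ʷ 7 (closed G) ≡ + 7 * q
    multiple = prime∣closedWalks G (from-yes (prime? 7))

    7∤ : ∀ q → + 37 * + 16529526 ≢ + 7 * q
    7∤ q eq = from-no (7 ∣? ℤ.∣ + 37 * + 16529526 ∣)
      (subst (7 ∣_) (sym (trans (cong ℤ.∣_∣ eq) (ℤ.abs-* (+ 7) q))) (m∣m*n ℤ.∣ q ∣))

-- The upper bound

bigPair? : (G : Graph n) (t : ℕ) → Dec (∃[ x ] ∃[ y ] Adj G x y × t ℕ.≤ length (commonNeighbours G x y))
bigPair? G t = Fin.any? λ x → Fin.any? λ y → adj? G x y ×-dec t ℕ.≤? length (commonNeighbours G x y)

-- Whether some edge has more than t common neighbours is decidable.
book-or-bounded : (G : Graph n) (t : ℕ) → book (suc t) ⊑ G ⊎ (∀ x y → Adj G x y → codegree G x y ≤ + t)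
book-or-bounded G t with bigPair? G (suc t)
... | yes (x , y , xy , t<) = inj₁ (book-from-edge G xy t<)
... | no  none = inj₂ λ x y xy → subst (_≤ + t) (codegree-length G x y)
  (ℤ.+≤+ (ℕ.≮⇒≥ λ t< → none (x , y , xy , t<)))

ramsey-upper : n ≡ 37 → RamseyProperty (book 8) (book 10) n
ramsey-upper n≡37 G with book-or-bounded G 7 | book-or-bounded (complement G) 9
... | inj₁ B   | _         = inj₁ B
... | inj₂ _   | inj₁ B    = inj₂ B
... | inj₂ red | inj₂ blue = contradiction n≡37 (StronglyRegular.impossible G regular codegree-value)
  where open Extremal n≡37 G red blue

theorem1 : IsRamseyNumber (book 8) (book 10) 37
theorem1 = ramsey-upper refl , ramsey-lower
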